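{- Let $F$ be a field, let $n,k\in\mathbb{Z}^+$, and let $$f(x_1,\ldots,x_n)=a_1x_1^k+\cdots+a_nx_n^k+g(x_1,\ldots,x_n)\in F[x_1,\ldots,x_n],$$ where $a_1,\ldots,a_n\in F\setminus\{0\}$ and $g\in F[x_1,\ldots,x_n]$ has $\deg g<k$. Then, for any finite nonempty subsets $A_1,\ldots,A_n$ of $F$, $$|\{f(x_1,\ldots,x_n):\ x_1\in A_1,\ldots,x_n\in A_n\}|\geq\min\left\{p(F),\ \sum_{i=1}^n\left\lfloor\frac{|A_i|-1}{k}\right\rfloor+1\right\}.$$
   Context: $\mathbb{Z}^+=\{1,2,3,\ldots\}$. For a field $F$, $p(F)$ denotes the additive order of the multiplicative identity of $F$: $p(F)=p$ if $F$ has prime characteristic $p$, and $p(F)=+\infty$ if $F$ has characteristic zero. $\deg g$ is the total degree of $g$; the zero polynomial is allowed as $g$ (its degree is regarded as less than $k$). $\lfloor\alpha\rfloor$ denotes the largest integer not exceeding the real number $\alpha$. -}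

module Defs where

open import Algebra.Bundles using (CommutativeRing; Semiring)
open import Algebra.Definitions using (Invertible)
import Algebra.Definitions.RawMonoid as RawMonoidDefs
import Algebra.Definitions.RawSemiring as RawSemiringDefs
open import Data.Bool.Base using (if_then_else_)
open import Data.Fin.Base using (Fin)
import Data.List.Base as List
open import Data.List.Base using (List; []; _∷_; _++_; length)
import Data.List.Membership.Setoid as Membership
import Data.List.Relation.Unary.Unique.Setoid as UniqueSetoid
import Data.Nat.Base as ℕ
open import Data.Nat.Base using (ℕ; _≤_; _<_)
import Data.Nat.Properties as ℕₚ
open import Data.Product.Base using (∃; _×_; _,_)
import Data.Vec.Base as Vec
open import Data.Vec.Base using (Vec; _[_]≔_)
open import Data.Vec.Functional using (Vector)
import Data.Vec.Properties as Vecₚ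
open import Level using (Level; suc; _⊔_)
open import Relation.Binary.PropositionalEquality.Core using (_≡_)
open import Relation.Nullary.Construct.Add.Supremum using (_⁺; [_]; ⊤⁺)
open import Relation.Nullary.Decidable.Core using (does)
open import Relation.Nullary.Negation.Core using (¬_)
open import Relation.Unary using (Pred; _∈_; _≐_)

-- Equality is not assumed decidable, and "nonzero" is the plain negation
-- of equality with zero (there is no separate apartness relation, as
-- there would be in a HeytingField).
record Field (c ℓ : Level) : Set (suc (c ⊔ ℓ)) where
  field
    commutativeRing : CommutativeRing c ℓ

  open CommutativeRing commutativeRing public

  Nonzero : Pred Carrier ℓ
  Nonzero x = ¬ (x ≈ 0#)

  field
    1≉0     : Nonzero 1#
    inverse : ∀ x → Nonzero x → Invertible _≈_ 1# _*_ x

sumℕ : ∀ {n} → Vector ℕ n → ℕ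
sumℕ = RawMonoidDefs.sum ℕ.+-0-rawMonoid

-- ℕ ⁺ is ℕ extended by a top element ⊤⁺ = +∞; the minimum of an
-- extended and an ordinary natural number is an ordinary one.
infixl 7 _⊓⁺_
_⊓⁺_ : ℕ ⁺ → ℕ → ℕ
[ p ] ⊓⁺ m = p ℕ.⊓ m
⊤⁺    ⊓⁺ m = m

module FieldDefs {c ℓ : Level} (F : Field c ℓ) where
  open Field F using (Carrier; Nonzero) public
  open Field F hiding (Carrier; Nonzero)
  open RawSemiringDefs (Semiring.rawSemiring semiring)
    using (_^_; product) renaming (_×_ to _·_)
  open Membership setoid using () renaming (_∈_ to _∈ₗ_)
  open UniqueSetoid setoid using (Unique)

  -- Here m · 1# is the m-fold sum 1# + ⋯ + 1#.  The value p(F) is given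
  -- as a relation, since the characteristic of an arbitrary field cannot
  -- be computed; at most one p satisfies it.
  IsAdditiveOrderOf1 : ℕ ⁺ → Set ℓ
  IsAdditiveOrderOf1 [ p ] =
    0 < p × (p · 1# ≈ 0#) × (∀ m → 0 < m → m < p → Nonzero (m · 1#))
  IsAdditiveOrderOf1 ⊤⁺    = ∀ m → 0 < m → Nonzero (m · 1#)

  -- S is finite with exactly N elements, up to the equality of F.
  HasCardinality : ∀ {s} → Pred Carrier s → ℕ → Set (c ⊔ ℓ ⊔ s)
  HasCardinality S N =
    ∃ λ (xs : List Carrier) → Unique xs × length xs ≡ N × S ≐ (_∈ₗ xs)

  -- A finite formal sum of terms c · x₁^e₁ ⋯ xₙ^eₙ.  Exponent vectors may
  -- be repeated and coefficients may be zero, so the polynomial a list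
  -- represents is determined by the function coeff below.
  Polynomial : ℕ → Set c
  Polynomial n = List (Carrier × Vec ℕ n)

  coeff : ∀ {n} → Polynomial n → Vec ℕ n → Carrier
  coeff []              e = 0#
  coeff ((b , e′) ∷ ts) e =
    if does (Vecₚ.≡-dec ℕₚ._≟_ e′ e) then b + coeff ts e else coeff ts e

  -- The total degree is less than k; true of the zero polynomial.
  DegreeLessThan : ∀ {n} → Polynomial n → ℕ → Set ℓ
  DegreeLessThan g k = ∀ e → k ≤ Vec.sum e → coeff g e ≈ 0#

  infixl 6 _+ₚ_
  _+ₚ_ : ∀ {n} → Polynomial n → Polynomial n → Polynomial n
  _+ₚ_ = _++_

  -- a₁x₁ᵏ + ⋯ + aₙxₙᵏ
  diagonal : ∀ {n} → Vector Carrier n → ℕ → Polynomial n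
  diagonal {n} a k = List.tabulate λ i → a i , (Vec.replicate n 0 [ i ]≔ k)

  eval : ∀ {n} → Polynomial n → Vector Carrier n → Carrier
  eval []             x = 0#
  eval ((b , e) ∷ ts) x = b * product (λ i → x i ^ Vec.lookup e i) + eval ts x

  -- {f(x₁,…,xₙ) : x₁ ∈ A₁, …, xₙ ∈ Aₙ}
  values : ∀ {n s} → Polynomial n → (Fin n → Pred Carrier s) →
           Pred Carrier (c ⊔ ℓ ⊔ s)
  values {n} f A y =
    ∃ λ (x : Vector Carrier n) → (∀ i → x i ∈ A i) × eval f x ≈ y

{-# OPTIONS --safe #-}
-- Polynomial method.  Suppose the value set has N elements, where N < p(F)
-- and N ≤ Σ ⌊(|Aᵢ| − 1)/k⌋, and choose mᵢ ≤ ⌊(|Aᵢ| − 1)/k⌋ with Σ mᵢ = N.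
-- The product of f − c over all values c vanishes on ∏ Aᵢ and equals
-- (a₁x₁ᵏ + ⋯ + aₙxₙᵏ)ᴺ plus terms of degree < kN.  On mᵢk + 1 points of Aᵢ the
-- divided difference kills x^j for j < mᵢk and sends x^(mᵢk) to 1; the tensor
-- product of these functionals kills degree < kN, so it extracts from the
-- product the coefficient (N! / ∏ mᵢ!) ∏ aᵢ^mᵢ, which is nonzero as N < p(F).
module Submission where

open import Defs
open import Algebra.Bundles using (Semiring)
import Algebra.Properties.CommutativeMonoid.Sum as CommutativeMonoidSum
import Algebra.Properties.CommutativeSemiring.Binomial as Binomial
import Algebra.Properties.Semiring.Exp as Exp
import Algebra.Properties.Semiring.Mult as Mult
import Algebra.Properties.Semiring.Sum as SemiringSum
import Algebra.Solver.Ring.NaturalCoefficients.Default as RingSolver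
open import Data.Fin.Base using (Fin; zero; suc; toℕ; fromℕ<; punchIn)
open import Data.Fin.Properties using (toℕ-fromℕ<; toℕ<n; toℕ-injective; punchInᵢ≢i)
import Data.List.Base as List
open import Data.List.Base using (List; []; _∷_; _++_; length; filter; cartesianProductWith)
import Data.List.Membership.Setoid as Membership
open import Data.List.Properties using (length-filter)
open import Data.List.Relation.Unary.All as All using (All; []; _∷_; tabulateₛ)
import Data.List.Relation.Unary.All.Properties as Allₚ
open import Data.List.Relation.Unary.AllPairs using (_∷_)
open import Data.List.Relation.Unary.Any using (here; there)
import Data.List.Relation.Unary.Unique.Setoid as UniqueSetoid
open import Data.Nat.Base as ℕ using (ℕ; zero; suc; NonZero; s≤s; _≤_; _<_; _!; _∸_)
open import Data.Nat.Combinatorics using (_C_; nCk≡n!/k![n-k]!; k![n∸k]!∣n!)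
open import Data.Nat.DivMod using (_/_; m/n*n≡m; m/n*n≤m)
import Data.Nat.Properties as ℕₚ
open import Data.Product.Base using (∃; _×_; _,_; proj₁; proj₂)
open import Data.Sum.Base using (_⊎_; inj₁; inj₂)
import Data.Vec.Base as Vec
open import Data.Vec.Base using (Vec; []; _∷_; _[_]≔_)
open import Data.Vec.Functional as Vector using (Vector)
import Data.Vec.Properties as Vecₚ
open import Function.Base using (_∘_; const)
open import Level using (_⊔_)
open import Relation.Binary.Definitions using (tri<; tri≈; tri>)
open import Relation.Binary.PropositionalEquality as ≡ using (_≡_; _≢_)
open import Relation.Nullary.Construct.Add.Supremum using (_⁺; [_]; ⊤⁺)
open import Relation.Nullary.Decidable using (yes; no; ¬?)
open import Relation.Nullary.Negation using (¬_; contradiction)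
open import Relation.Unary using (Pred; Satisfiable; _∈_)

-- Sums of natural numbers, exponent vectors and binomial coefficients

-- Greedy choice: the first index takes `M zero ⊓ N`, and the remaining `N ∸ M zero` is handed on.
-- Under truncated subtraction these two parts always add up to `N`.
choose-below : ∀ {n} (M : Vector ℕ n) N → N ≤ sumℕ M →
               ∃ λ (m : Vector ℕ n) → (∀ i → m i ≤ M i) × sumℕ m ≡ N
choose-below {zero}  M zero N≤ = M , (λ ()) , ≡.refl
choose-below {suc n} M N    N≤
  with choose-below (M ∘ suc) (N ∸ M zero)
         (ℕₚ.m≤n+o⇒m∸n≤o N (M zero) N≤)
... | m , m≤M , Σm≡ =
  (M zero ℕ.⊓ N) Vector.∷ m
  , (λ { zero → ℕₚ.m⊓n≤m (M zero) N ; (suc i) → m≤M i })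
  , ≡.trans (≡.cong (M zero ℕ.⊓ N ℕ.+_) Σm≡) (ℕₚ.m⊓n+n∸m≡n (M zero) N)

sumℕ-* : ∀ {n} (m : Vector ℕ n) k → sumℕ (λ i → m i ℕ.* k) ≡ sumℕ m ℕ.* k
sumℕ-* {zero}  m k = ≡.refl
sumℕ-* {suc n} m k = ≡.trans (≡.cong (m zero ℕ.* k ℕ.+_) (sumℕ-* (m ∘ suc) k))
  (≡.sym (ℕₚ.*-distribʳ-+ k (m zero) (sumℕ (m ∘ suc))))

sum-zipWith-+ : ∀ {n} (e e′ : Vec ℕ n) →
                Vec.sum (Vec.zipWith ℕ._+_ e e′) ≡ Vec.sum e ℕ.+ Vec.sum e′
sum-zipWith-+ []      []        = ≡.refl
sum-zipWith-+ (j ∷ e) (j′ ∷ e′) = ≡.trans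
  (≡.cong (j ℕ.+ j′ ℕ.+_) (sum-zipWith-+ e e′))
  (interchange j j′ (Vec.sum e) (Vec.sum e′))
  where open import Algebra.Properties.CommutativeSemigroup ℕₚ.+-commutativeSemigroup

sum-replicate-0 : ∀ n → Vec.sum (Vec.replicate n 0) ≡ 0
sum-replicate-0 zero    = ≡.refl
sum-replicate-0 (suc n) = sum-replicate-0 n

sum-single-exponent : ∀ {n} (i : Fin n) k →
                      Vec.sum (Vec.replicate n 0 [ i ]≔ k) ≡ k
sum-single-exponent {suc n} zero    k =
  ≡.trans (≡.cong (k ℕ.+_) (sum-replicate-0 n)) (ℕₚ.+-identityʳ k)
sum-single-exponent {suc n} (suc i) k = sum-single-exponent i k

-- A form without division, so that the identity can be carried into `F` along the map taking `j` to
-- `j · 1#`.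
nCk*k![n∸k]!≡n! : ∀ {n k} → k ≤ n → (n C k) ℕ.* (k ! ℕ.* (n ∸ k) !) ≡ n !
nCk*k![n∸k]!≡n! {n} {k} k≤n = ≡.trans
  (≡.cong (ℕ._* (k ! ℕ.* (n ∸ k) !)) (nCk≡n!/k![n-k]! k≤n))
  (m/n*n≡m (k![n∸k]!∣n! k≤n))
  where instance _ = k ℕₚ.!* (n ∸ k) !≢0

module Functionals {c ℓ} (F : Field c ℓ) where
  open Field F hiding (Carrier; Nonzero; zero)
  open FieldDefs F
  open Exp semiring using (_^_; ^-congʳ; ^-homo-*; ^-assocʳ)
  open import Algebra.Properties.CommutativeSemiring.Exp commutativeSemiring using (^-distrib-*)
  open Mult semiring using (×-congʳ; ×-assoc-*; ×1-homo-*) renaming (_×_ to _·_)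
  open SemiringSum semiring using (sum; sum-cong-≋; sum-replicate-zero)
  open CommutativeMonoidSum +-commutativeMonoid using (sum-remove)
  open import Algebra.Definitions.RawSemiring (Semiring.rawSemiring semiring) using (product)
  open Membership setoid using () renaming (_∈_ to _∈ₗ_)
  open UniqueSetoid setoid using (Unique)
  open import Relation.Binary.Reasoning.Setoid setoid
  open RingSolver commutativeSemiring using (solve; _:=_; _:+_; _:*_)

  -- Nonzero elements and the characteristic

  *-nonzero : ∀ {x y} → Nonzero x → Nonzero y → Nonzero (x * y)
  *-nonzero {x} {y} x≉0 y≉0 xy≈0 with inverse x x≉0
  ... | x⁻¹ , x⁻¹x≈1 , _ = y≉0 (begin
    y              ≈⟨ *-identityˡ y ⟨
    1# * y         ≈⟨ *-congʳ x⁻¹x≈1 ⟨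
    (x⁻¹ * x) * y  ≈⟨ *-assoc x⁻¹ x y ⟩
    x⁻¹ * (x * y)  ≈⟨ *-congˡ xy≈0 ⟩
    x⁻¹ * 0#       ≈⟨ zeroʳ x⁻¹ ⟩
    0#             ∎)

  ^-nonzero : ∀ {x} → Nonzero x → ∀ n → Nonzero (x ^ n)
  ^-nonzero x≉0 zero    = 1≉0
  ^-nonzero x≉0 (suc n) = *-nonzero x≉0 (^-nonzero x≉0 n)

  -- Encodes N < p(F) without a case distinction between finite and infinite p(F).
  CharacteristicExceeds : ℕ → Set ℓ
  CharacteristicExceeds N = ∀ j → 0 < j → j ≤ N → Nonzero (j · 1#)

  !-nonzero : ∀ N → CharacteristicExceeds N → Nonzero ((N !) · 1#)
  !-nonzero zero    char 1·1≈0 = 1≉0 (trans (sym (+-identityʳ 1#)) 1·1≈0)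
  !-nonzero (suc N) char [N+1]!≈0 =
    *-nonzero (char (suc N) ℕ.z<s ℕₚ.≤-refl)
              (!-nonzero N (λ j 0<j j≤N → char j 0<j (ℕₚ.m≤n⇒m≤1+n j≤N)))
              (trans (sym (×1-homo-* (suc N) (N !))) [N+1]!≈0)

  -- The binomial coefficient divides `N !`, whose image in `F` is a product of the nonzero elements
  -- 1, ..., N.
  C-nonzero : ∀ {N j} → CharacteristicExceeds N → j ≤ N → Nonzero ((N C j) · 1#)
  C-nonzero {N} {j} char j≤N C≈0 = !-nonzero N char (begin
    (N !) · 1#                                       ≡⟨ ≡.cong (_· 1#) (nCk*k![n∸k]!≡n! j≤N) ⟨
    ((N C j) ℕ.* (j ! ℕ.* (N ∸ j) !)) · 1#         ≈⟨ ×1-homo-* (N C j) (j ! ℕ.* (N ∸ j) !) ⟩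
    ((N C j) · 1#) * ((j ! ℕ.* (N ∸ j) !) · 1#)    ≈⟨ *-congʳ C≈0 ⟩
    0# * ((j ! ℕ.* (N ∸ j) !) · 1#)                ≈⟨ zeroˡ _ ⟩
    0#                                             ∎)

  -- Finite sums in the field

  sum-zero : ∀ {n} (t : Vector Carrier n) → (∀ i → t i ≈ 0#) → sum t ≈ 0#
  sum-zero {n} t t≈0 = trans (sum-cong-≋ t≈0) (sum-replicate-zero n)

  sum-single : ∀ (t : ℕ → Carrier) {N m} → m ≤ N →
               (∀ j → j ≤ N → j ≢ m → t j ≈ 0#) →
               sum {suc N} (t ∘ toℕ) ≈ t m
  sum-single t {N} {m} m≤N t≈0 = begin
    sum {suc N} (t ∘ toℕ)                          ≈⟨ sum-remove {i = i} (t ∘ toℕ) ⟩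
    t (toℕ i) + sum (Vector.removeAt (t ∘ toℕ) i)  ≈⟨ +-congˡ (sum-zero _ rest≈0) ⟩
    t (toℕ i) + 0#                                 ≈⟨ +-identityʳ _ ⟩
    t (toℕ i)                                      ≡⟨ ≡.cong t toℕi≡m ⟩
    t m                                            ∎
    where
    i : Fin (suc N)
    i = fromℕ< (s≤s m≤N)
    toℕi≡m : toℕ i ≡ m
    toℕi≡m = toℕ-fromℕ< (s≤s m≤N)
    rest≈0 : ∀ j → t (toℕ (punchIn i j)) ≈ 0#
    rest≈0 j = t≈0 _ (ℕₚ.≤-pred (toℕ<n (punchIn i j)))
      λ eq → punchInᵢ≢i i j (toℕ-injective (≡.trans eq (≡.sym toℕi≡m)))

  -- Linear functionals given by weighted points

  -- Linear functionals on functions X → Carrier: h ↦ Σ w · h x over the pairs (w , x).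
  WeightedPoints : ∀ {a} → Set a → Set (c ⊔ a)
  WeightedPoints X = List (Carrier × X)

  ⟨_,_⟩ : ∀ {a} {X : Set a} → WeightedPoints X → (X → Carrier) → Carrier
  ⟨ []          , h ⟩ = 0#
  ⟨ (w , x) ∷ W , h ⟩ = w * h x + ⟨ W , h ⟩

  module _ {a} {X : Set a} where

    -- A functional sees a function only at its own points. This lets a function that vanishes
    -- merely on the product of the `A i` be replaced by zero.
    ⟨⟩-congᵃ : ∀ {h h′ : X → Carrier} {W} →
               All (λ wx → h (proj₂ wx) ≈ h′ (proj₂ wx)) W → ⟨ W , h ⟩ ≈ ⟨ W , h′ ⟩
    ⟨⟩-congᵃ []       = refl
    ⟨⟩-congᵃ (p ∷ ps) = +-cong (*-congˡ p) (⟨⟩-congᵃ ps)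

    ⟨⟩-cong : ∀ W {h h′ : X → Carrier} → (∀ x → h x ≈ h′ x) → ⟨ W , h ⟩ ≈ ⟨ W , h′ ⟩
    ⟨⟩-cong W h≈h′ = ⟨⟩-congᵃ (All.universal (h≈h′ ∘ proj₂) W)

    ⟨⟩-0 : ∀ (W : WeightedPoints X) → ⟨ W , const 0# ⟩ ≈ 0#
    ⟨⟩-0 []            = refl
    ⟨⟩-0 ((w , _) ∷ W) = trans (+-cong (zeroʳ w) (⟨⟩-0 W)) (+-identityʳ 0#)

    ⟨⟩-+ : ∀ W (h h′ : X → Carrier) →
           ⟨ W , (λ x → h x + h′ x) ⟩ ≈ ⟨ W , h ⟩ + ⟨ W , h′ ⟩
    ⟨⟩-+ []            h h′ = sym (+-identityʳ 0#)
    ⟨⟩-+ ((w , x) ∷ W) h h′ = trans (+-congˡ (⟨⟩-+ W h h′))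
      (solve 5 (λ w y y′ s s′ →
        w :* (y :+ y′) :+ (s :+ s′) := (w :* y :+ s) :+ (w :* y′ :+ s′))
        refl w (h x) (h′ x) ⟨ W , h ⟩ ⟨ W , h′ ⟩)

    ⟨⟩-* : ∀ W b (h : X → Carrier) → ⟨ W , (λ x → b * h x) ⟩ ≈ b * ⟨ W , h ⟩
    ⟨⟩-* []            b h = sym (zeroʳ b)
    ⟨⟩-* ((w , x) ∷ W) b h = trans (+-congˡ (⟨⟩-* W b h))
      (solve 4 (λ w b y s → w :* (b :* y) :+ b :* s := b :* (w :* y :+ s))
        refl w b (h x) ⟨ W , h ⟩)

    ⟨⟩-sum : ∀ W {n} (h : Fin n → X → Carrier) →
             ⟨ W , (λ x → sum (λ i → h i x)) ⟩ ≈ sum (λ i → ⟨ W , h i ⟩)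
    ⟨⟩-sum W {zero}  h = ⟨⟩-0 W
    ⟨⟩-sum W {suc n} h =
      trans (⟨⟩-+ W (h zero) _) (+-congˡ (⟨⟩-sum W (h ∘ suc)))

    ⟨⟩-++ : ∀ W W′ (h : X → Carrier) → ⟨ W ++ W′ , h ⟩ ≈ ⟨ W , h ⟩ + ⟨ W′ , h ⟩
    ⟨⟩-++ []            W′ h = sym (+-identityˡ _)
    ⟨⟩-++ ((w , x) ∷ W) W′ h = trans (+-congˡ (⟨⟩-++ W W′ h)) (sym (+-assoc _ _ _))

  -- Divided differences

  -- V has weights w / (x − b), and x^(j+1) / (x − b) = b x^j / (x − b) + x^j.
  divide-weights :
    ∀ {p} {P : Pred Carrier p} b (W : WeightedPoints Carrier) →
    All (λ wx → P (proj₂ wx) × ¬ (b ≈ proj₂ wx)) W →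
    ∃ λ (V : WeightedPoints Carrier) → All (P ∘ proj₂) V ×
      (∀ j → ⟨ V , _^ suc j ⟩ ≈ b * ⟨ V , _^ j ⟩ + ⟨ W , _^ j ⟩)
  divide-weights b [] [] = [] , [] , λ j → sym (trans (+-identityʳ _) (zeroʳ b))
  divide-weights {P = P} b ((w , x) ∷ W) ((Px , b≉x) ∷ ps)
    with divide-weights {P = P} b W ps | inverse (x - b) (λ x-b≈0 → b≉x (sym (x∙y⁻¹≈ε⇒x≈y x b x-b≈0)))
    where open import Algebra.Properties.Group +-group using (x∙y⁻¹≈ε⇒x≈y)
  ... | V , PV , moments | u , u[x-b]≈1 , _ = (w * u , x) ∷ V , Px ∷ PV , λ j → begin
    (w * u) * (x * x ^ j) + ⟨ V , _^ suc j ⟩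
      ≈⟨ +-cong (solve 4 (λ w u x y → (w :* u) :* (x :* y) := w :* (u :* x) :* y)
                  refl w u x (x ^ j)) (moments j) ⟩
    w * (u * x) * x ^ j + (b * ⟨ V , _^ j ⟩ + ⟨ W , _^ j ⟩)
      ≈⟨ +-congʳ (*-congʳ (*-congˡ ux≈ub+1)) ⟩
    w * (u * b + 1#) * x ^ j + (b * ⟨ V , _^ j ⟩ + ⟨ W , _^ j ⟩)
      ≈⟨ +-congʳ (*-congʳ (trans (distribˡ w _ _) (+-congˡ (*-identityʳ w)))) ⟩
    (w * (u * b) + w) * x ^ j + (b * ⟨ V , _^ j ⟩ + ⟨ W , _^ j ⟩)
      ≈⟨ solve 6 (λ w u b y s t →
           (w :* (u :* b) :+ w) :* y :+ (b :* s :+ t)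
             := b :* ((w :* u) :* y :+ s) :+ (w :* y :+ t))
           refl w u b (x ^ j) ⟨ V , _^ j ⟩ ⟨ W , _^ j ⟩ ⟩
    b * ((w * u) * x ^ j + ⟨ V , _^ j ⟩) + (w * x ^ j + ⟨ W , _^ j ⟩) ∎
    where
    ux≈ub+1 : u * x ≈ u * b + 1#
    ux≈ub+1 = begin
      u * x                  ≈⟨ *-congˡ (+-identityʳ x) ⟨
      u * (x + 0#)           ≈⟨ *-congˡ (+-congˡ (-‿inverseˡ b)) ⟨
      u * (x + (- b + b))    ≈⟨ solve 4 (λ u x b′ b → u :* (x :+ (b′ :+ b)) := u :* b :+ u :* (x :+ b′))
                                  refl u x (- b) b ⟩
      u * b + u * (x - b)    ≈⟨ +-congˡ u[x-b]≈1 ⟩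
      u * b + 1#             ∎

  -- On polynomials of degree at most `d` such a functional reads off the coefficient of x^d, using
  -- only points of `P`.
  DividedDifference : ∀ {p} → Pred Carrier p → ℕ → WeightedPoints Carrier → Set _
  DividedDifference P d W =
    All (P ∘ proj₂) W × (∀ j → j < d → ⟨ W , _^ j ⟩ ≈ 0#) × ⟨ W , _^ d ⟩ ≈ 1#

  -- Induction on `d`: set one point `b` aside, take the functional of order `d` on the other
  -- points, divide its weights by x - b, and give `b` the weight that makes the total weight zero.
  -- The moment recurrence then raises the order by one.
  divided-difference : ∀ {p} (P : Pred Carrier p) d xs → Unique xs → All P xs →
                       d < length xs → ∃ (DividedDifference P d)
  divided-difference P zero (b ∷ xs) _ (Pb ∷ _) _ =
    (1# , b) ∷ [] , Pb ∷ [] , (λ _ ()) , trans (+-identityʳ _) (*-identityʳ 1#)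
  divided-difference P (suc d) (b ∷ xs) (b∉xs ∷ uniq) (Pb ∷ Pxs) (s≤s d<)
    -- The predicate is strengthened to exclude `b`, so that x - b is invertible at every point of
    -- `W`.
    with divided-difference (λ x → P x × ¬ (b ≈ x)) d xs uniq (All.zip (Pxs , b∉xs)) d<
  ... | W , PW , W-low , W-top with divide-weights {P = P} b W PW
  ... | V , PV , V-moments = U , Pb ∷ PV , U-low , U-top
    where
    U : WeightedPoints Carrier
    -- The weight at `b` cancels the zeroth moment of `V`.
    U = (- ⟨ V , const 1# ⟩ , b) ∷ V

    -- Adding a multiple of evaluation at `b` preserves the recurrence for `V`, because b^(j+1) = b
    -- b^j.
    U-moments : ∀ j → ⟨ U , _^ suc j ⟩ ≈ b * ⟨ U , _^ j ⟩ + ⟨ W , _^ j ⟩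
    U-moments j = trans (+-congˡ (V-moments j))
      (solve 5 (λ z b y s t → z :* (b :* y) :+ (b :* s :+ t) := b :* (z :* y :+ s) :+ t)
        refl (- ⟨ V , const 1# ⟩) b (b ^ j) ⟨ V , _^ j ⟩ ⟨ W , _^ j ⟩)

    U-low : ∀ j → j < suc d → ⟨ U , _^ j ⟩ ≈ 0#
    U-low zero    _        = trans (+-congʳ (*-identityʳ _)) (-‿inverseˡ _)
    U-low (suc j) (s≤s j<) = begin
      ⟨ U , _^ suc j ⟩                  ≈⟨ U-moments j ⟩
      b * ⟨ U , _^ j ⟩ + ⟨ W , _^ j ⟩   ≈⟨ +-cong (*-congˡ (U-low j (ℕₚ.m≤n⇒m≤1+n j<))) (W-low j j<) ⟩
      b * 0# + 0#                       ≈⟨ trans (+-identityʳ _) (zeroʳ b) ⟩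
      0#                                ∎

    U-top : ⟨ U , _^ suc d ⟩ ≈ 1#
    U-top = begin
      ⟨ U , _^ suc d ⟩                  ≈⟨ U-moments d ⟩
      b * ⟨ U , _^ d ⟩ + ⟨ W , _^ d ⟩   ≈⟨ +-cong (*-congˡ (U-low d ℕₚ.≤-refl)) W-top ⟩
      b * 0# + 1#                       ≈⟨ +-congʳ (zeroʳ b) ⟩
      0# + 1#                           ≈⟨ +-identityˡ 1# ⟩
      1#                                ∎

  -- Tensor products of functionals

  scale-cons : ∀ {n} → Carrier × Carrier → Carrier × Vector Carrier n →
               Carrier × Vector Carrier (suc n)
  scale-cons (w , b) (w′ , x) = w * w′ , b Vector.∷ x

  infixr 7 _⊗_
  _⊗_ : ∀ {n} → WeightedPoints Carrier → WeightedPoints (Vector Carrier n) →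
        WeightedPoints (Vector Carrier (suc n))
  _⊗_ = cartesianProductWith scale-cons

  ⨂ : ∀ {n} → Vector (WeightedPoints Carrier) n → WeightedPoints (Vector Carrier n)
  ⨂ {zero}  W = (1# , λ ()) ∷ []
  ⨂ {suc n} W = W zero ⊗ ⨂ (W ∘ suc)

  -- Finite Fubini. The factorisation of `h` is a pointwise hypothesis, so `h` need not be written
  -- literally as a product.
  ⟨⊗⟩ : ∀ {n} W W′ {h : Vector Carrier (suc n) → Carrier}
        (u : Carrier → Carrier) (v : Vector Carrier n → Carrier) →
        (∀ b x → h (b Vector.∷ x) ≈ u b * v x) →
        ⟨ W ⊗ W′ , h ⟩ ≈ ⟨ W , u ⟩ * ⟨ W′ , v ⟩
  ⟨⊗⟩ []            W′     u v h≈ = sym (zeroˡ _)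
  ⟨⊗⟩ ((w , b) ∷ W) W′ {h} u v h≈ = begin
    ⟨ List.map (scale-cons (w , b)) W′ ++ (W ⊗ W′) , h ⟩
      ≈⟨ ⟨⟩-++ (List.map (scale-cons (w , b)) W′) (W ⊗ W′) h ⟩
    ⟨ List.map (scale-cons (w , b)) W′ , h ⟩ + ⟨ W ⊗ W′ , h ⟩
      ≈⟨ +-cong (slice W′) (⟨⊗⟩ W W′ u v h≈) ⟩
    (w * u b) * ⟨ W′ , v ⟩ + ⟨ W , u ⟩ * ⟨ W′ , v ⟩
      ≈⟨ distribʳ _ _ _ ⟨
    (w * u b + ⟨ W , u ⟩) * ⟨ W′ , v ⟩ ∎
    where
    slice : ∀ W′ → ⟨ List.map (scale-cons (w , b)) W′ , h ⟩ ≈ (w * u b) * ⟨ W′ , v ⟩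
    slice []              = sym (zeroʳ _)
    slice ((w′ , x) ∷ W′) = trans (+-cong (*-congˡ (h≈ b x)) (slice W′))
      (solve 5 (λ w w′ y z s →
        (w :* w′) :* (y :* z) :+ (w :* y) :* s := (w :* y) :* (w′ :* z :+ s))
        refl w w′ (u b) (v x) ⟨ W′ , v ⟩)

  All-⨂ : ∀ {n s} {A : Fin n → Pred Carrier s} (W : Vector (WeightedPoints Carrier) n) →
          (∀ i → All ((_∈ A i) ∘ proj₂) (W i)) →
          All (λ wx → ∀ i → proj₂ wx i ∈ A i) (⨂ W)
  All-⨂ {zero}          W all = (λ ()) ∷ []
  All-⨂ {suc n} {A = A} W all = go (W zero) (all zero)
    where
    rest = All-⨂ (W ∘ suc) (all ∘ suc)
    go : ∀ V → All ((_∈ A zero) ∘ proj₂) V →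
         All (λ wx → ∀ i → proj₂ wx i ∈ A i) (V ⊗ ⨂ (W ∘ suc))
    go []      []       = []
    go (_ ∷ V) (p ∷ ps) = Allₚ.++⁺
      (Allₚ.gmap⁺ (λ q → λ { zero → p ; (suc i) → q i }) rest)
      (go V ps)

  -- Monomials and degree bounds

  monomial : ∀ {n} → Vec ℕ n → Vector Carrier n → Carrier
  monomial e x = product (λ i → x i ^ Vec.lookup e i)

  monomial-* : ∀ {n} (e e′ : Vec ℕ n) x →
               monomial (Vec.zipWith ℕ._+_ e e′) x ≈ monomial e x * monomial e′ x
  monomial-* []      []        x = sym (*-identityˡ 1#)
  monomial-* (j ∷ e) (j′ ∷ e′) x = trans
    (*-cong (^-homo-* (x zero) j j′) (monomial-* e e′ (x ∘ suc)))
    (solve 4 (λ y y′ z z′ → (y :* y′) :* (z :* z′) := (y :* z) :* (y′ :* z′))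
      refl (x zero ^ j) (x zero ^ j′) (monomial e (x ∘ suc)) (monomial e′ (x ∘ suc)))

  monomial-0 : ∀ {n} (x : Vector Carrier n) → monomial (Vec.replicate n 0) x ≈ 1#
  monomial-0 {zero}  x = refl
  monomial-0 {suc n} x = trans (*-identityˡ _) (monomial-0 (x ∘ suc))

  monomial-single : ∀ {n} (i : Fin n) k x →
                    monomial (Vec.replicate n 0 [ i ]≔ k) x ≈ x i ^ k
  monomial-single zero    k x = trans (*-congˡ (monomial-0 (x ∘ suc))) (*-identityʳ _)
  monomial-single (suc i) k x = trans (*-identityˡ _) (monomial-single i k (x ∘ suc))

  -- A property of functions instead of formal polynomials: `h` agrees pointwise with some linear
  -- combination of monomials of total degree below `D`. Over a finite field the same function may
  -- come from other polynomials of larger degree. Proofs by linearity become inductions on the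
  -- derivation.
  data DegreeBelow {n} (D : ℕ) : (Vector Carrier n → Carrier) → Set (c ⊔ ℓ) where
    mono  : ∀ e → Vec.sum e < D → DegreeBelow D (monomial e)
    null  : DegreeBelow D (const 0#)
    plus  : ∀ {h h′} → DegreeBelow D h → DegreeBelow D h′ → DegreeBelow D (λ x → h x + h′ x)
    scale : ∀ b {h} → DegreeBelow D h → DegreeBelow D (λ x → b * h x)
    resp  : ∀ {h h′} → (∀ x → h x ≈ h′ x) → DegreeBelow D h → DegreeBelow D h′

  module _ {n : ℕ} where

    weaken : ∀ {D D′} {h : Vector Carrier n → Carrier} → D ≤ D′ →
             DegreeBelow D h → DegreeBelow D′ h
    weaken D≤ (mono e e<)    = mono e (ℕₚ.≤-trans e< D≤)
    weaken D≤ null           = null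
    weaken D≤ (plus p q)     = plus (weaken D≤ p) (weaken D≤ q)
    weaken D≤ (scale b p)    = scale b (weaken D≤ p)
    weaken D≤ (resp h≈h′ p)  = resp h≈h′ (weaken D≤ p)

    degree-constant : ∀ {D} → 0 < D → ∀ b → DegreeBelow {n} D (const b)
    degree-constant 0<D b = resp (λ x → trans (*-congˡ (monomial-0 x)) (*-identityʳ b))
      (scale b (mono (Vec.replicate n 0) (≡.subst (_< _) (≡.sym (sum-replicate-0 n)) 0<D)))

    degree-sum : ∀ {D m} (h : Fin m → Vector Carrier n → Carrier) →
                 (∀ i → DegreeBelow D (h i)) → DegreeBelow D (λ x → sum (λ i → h i x))
    degree-sum {m = zero}  h h< = null
    degree-sum {m = suc m} h h< = plus (h< zero) (degree-sum (h ∘ suc) (h< ∘ suc))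

    -- One strict bound suffices: degrees below `D` and at most `D′` add up to less than `D + D′`.
    -- Bilinearity reduces the claim to two monomials.
    degree-* : ∀ {D D′} {h h′ : Vector Carrier n → Carrier} →
               DegreeBelow D h → DegreeBelow (suc D′) h′ →
               DegreeBelow (D ℕ.+ D′) (λ x → h x * h′ x)
    degree-* {D} {D′} (mono e e<) = go
      where
      go : ∀ {h′ : Vector Carrier n → Carrier} → DegreeBelow (suc D′) h′ →
           DegreeBelow (D ℕ.+ D′) (λ x → monomial e x * h′ x)
      go (mono e′ e′<) = resp (monomial-* e e′)
        (mono (Vec.zipWith ℕ._+_ e e′)
          (≡.subst (_< D ℕ.+ D′) (≡.sym (sum-zipWith-+ e e′))
            (ℕₚ.+-mono-<-≤ e< (ℕₚ.≤-pred e′<))))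
      go null          = resp (λ x → sym (zeroʳ _)) null
      go (plus p q)    = resp (λ x → sym (distribˡ _ _ _)) (plus (go p) (go q))
      go (scale b {h} p) = resp
        (λ x → solve 3 (λ b y z → b :* (y :* z) := y :* (b :* z)) refl b (monomial e x) (h x))
        (scale b (go p))
      go (resp h≈h′ p) = resp (λ x → *-congˡ (h≈h′ x)) (go p)
    degree-* null          r = resp (λ x → sym (zeroˡ _)) null
    degree-* (plus p q)    r = resp (λ x → sym (distribʳ _ _ _)) (plus (degree-* p r) (degree-* q r))
    degree-* (scale b p)   r = resp (λ x → sym (*-assoc b _ _)) (scale b (degree-* p r))
    degree-* (resp h≈h′ p) r = resp (λ x → *-congʳ (h≈h′ x)) (degree-* p r)

    degree-^ : ∀ {D} {h : Vector Carrier n → Carrier} → DegreeBelow (suc D) h →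
               ∀ N → DegreeBelow (suc (N ℕ.* D)) (λ x → h x ^ N)
    degree-^ h< zero    = degree-constant ℕ.z<s 1#
    degree-^ h< (suc N) = degree-* h< (degree-^ h< N)

    -- Collecting like terms of a formal polynomial

    _without_ : Polynomial n → Vec ℕ n → Polynomial n
    g without e = filter (λ t → ¬? (Vecₚ.≡-dec ℕₚ._≟_ (proj₂ t) e)) g

    eval-without : ∀ (g : Polynomial n) e x →
                   eval g x ≈ coeff g e * monomial e x + eval (g without e) x
    eval-without []             e x = sym (trans (+-identityʳ _) (zeroˡ _))
    eval-without ((b , e′) ∷ g) e x with Vecₚ.≡-dec ℕₚ._≟_ e′ e
    ... | yes ≡.refl = trans (+-congˡ (eval-without g e x))
      (solve 4 (λ b y z s → b :* y :+ (z :* y :+ s) := (b :+ z) :* y :+ s)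
        refl b (monomial e x) (coeff g e) (eval (g without e) x))
    ... | no  _      = trans (+-congˡ (eval-without g e x))
      (solve 3 (λ y z s → y :+ (z :+ s) := z :+ (y :+ s))
        refl (b * monomial e′ x) (coeff g e * monomial e x) (eval (g without e) x))

    coeff-without-≡ : ∀ (g : Polynomial n) e → coeff (g without e) e ≈ 0#
    coeff-without-≡ []             e = refl
    coeff-without-≡ ((b , e′) ∷ g) e with Vecₚ.≡-dec ℕₚ._≟_ e′ e in eq
    ... | yes _ = coeff-without-≡ g e
    -- The head survives the filter, so `coeff` compares `e′` with `e` once more; `eq` settles that
    -- second test.
    ... | no  _ rewrite eq = coeff-without-≡ g e

    coeff-without-≢ : ∀ (g : Polynomial n) {e e″} → e ≢ e″ →
                      coeff (g without e) e″ ≈ coeff g e″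
    coeff-without-≢ []             e≢e″ = refl
    coeff-without-≢ ((b , e′) ∷ g) {e} {e″} e≢e″ with Vecₚ.≡-dec ℕₚ._≟_ e′ e
    coeff-without-≢ ((b , e′) ∷ g) {e} {e″} e≢e″ | yes ≡.refl
      with Vecₚ.≡-dec ℕₚ._≟_ e′ e″
    ... | yes e≡e″ = contradiction e≡e″ e≢e″
    ... | no  _    = coeff-without-≢ g e≢e″
    coeff-without-≢ ((b , e′) ∷ g) {e} {e″} e≢e″ | no _
      with Vecₚ.≡-dec ℕₚ._≟_ e′ e″
    ... | yes _ = +-congˡ (coeff-without-≢ g e≢e″)
    ... | no  _ = coeff-without-≢ g e≢e″

    degree-without : ∀ {g : Polynomial n} {k} e → DegreeLessThan g k →
                     DegreeLessThan (g without e) k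
    degree-without {g} e g<k e″ k≤ with Vecₚ.≡-dec ℕₚ._≟_ e e″
    ... | yes ≡.refl = coeff-without-≡ g e
    ... | no  e≢e″   = trans (coeff-without-≢ g e≢e″) (g<k e″ k≤)

    -- Single terms of g may have large degree and only cancel in total, so
    -- terms with equal exponents are collected one exponent at a time.
    degree-eval : ∀ {k} (g : Polynomial n) → DegreeLessThan g k → DegreeBelow k (eval g)
    degree-eval {k} g g<k = go (length g) g ℕₚ.≤-refl g<k
      where
      -- The recursion is on a filtered list, which is not a structural part of `g`; the length
      -- bound `L` makes it terminate.
      go : ∀ L (g : Polynomial n) → length g ≤ L → DegreeLessThan g k → DegreeBelow k (eval g)
      go L       []               _  g<k = null
      go (suc L) g@((b , e) ∷ ts) (s≤s ≤L) g<k =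
        resp (λ x → sym (eval-without g e x)) (plus (leading (ℕₚ.<-≤-connex (Vec.sum e) k)) rest)
        where
        leading : Vec.sum e < k ⊎ k ≤ Vec.sum e →
                  DegreeBelow k (λ x → coeff g e * monomial e x)
        leading (inj₁ e<k) = scale _ (mono e e<k)
        -- A collected term of degree at least `k` has total coefficient zero by hypothesis.
        leading (inj₂ k≤e) = resp (λ x → sym (trans (*-congʳ (g<k e k≤e)) (zeroˡ _))) null

        shorter : length (g without e) ≤ L
        shorter with Vecₚ.≡-dec ℕₚ._≟_ e e
        ... | yes _  = ℕₚ.≤-trans (length-filter _ ts) ≤L
        ... | no e≢e = contradiction ≡.refl e≢e

        rest : DegreeBelow k (eval (g without e))
        rest = go L (g without e) shorter (degree-without {g} e g<k)

    eval-++ : ∀ (f g : Polynomial n) x → eval (f ++ g) x ≈ eval f x + eval g x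
    eval-++ []            g x = sym (+-identityˡ _)
    eval-++ ((b , e) ∷ f) g x = trans (+-congˡ (eval-++ f g x)) (sym (+-assoc _ _ _))

    eval-tabulate : ∀ {m} (a : Vector Carrier m) (e : Fin m → Vec ℕ n) x →
      eval (List.tabulate λ i → a i , e i) x ≈ sum (λ i → a i * monomial (e i) x)
    eval-tabulate {zero}  a e x = refl
    eval-tabulate {suc m} a e x = +-congˡ (eval-tabulate (a ∘ suc) (e ∘ suc) x)

  -- The diagonal form

  powerSum : ∀ {n} → Vector Carrier n → ℕ → Vector Carrier n → Carrier
  powerSum a k x = sum (λ i → a i * x i ^ k)

  eval-diagonal : ∀ {n} (a : Vector Carrier n) k x → eval (diagonal a k) x ≈ powerSum a k x
  eval-diagonal a k x = trans (eval-tabulate a _ x)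
    (sum-cong-≋ (λ i → *-congˡ (monomial-single i k x)))

  degree-powerSum : ∀ {n} (a : Vector Carrier n) k → DegreeBelow (suc k) (powerSum a k)
  degree-powerSum a k = degree-sum _ λ i → scale (a i)
    (resp (monomial-single i k) (mono (Vec.replicate _ 0 [ i ]≔ k) (s≤s (ℕₚ.≤-reflexive (sum-single-exponent i k)))))

  -- The tensor functional on low degrees and on powers of the diagonal form

  -- Pigeonhole: if the exponents sum to less than the orders `d i` do, some exponent lies below its
  -- order, and the corresponding factor of the value is zero.
  ⨂-monomial : ∀ {n} (W : Vector (WeightedPoints Carrier) n) (d : Vector ℕ n) →
    (∀ i j → j < d i → ⟨ W i , _^ j ⟩ ≈ 0#) →
    ∀ e → Vec.sum e < sumℕ d → ⟨ ⨂ W , monomial e ⟩ ≈ 0#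
  ⨂-monomial {zero}  W d low e       ()
  ⨂-monomial {suc n} W d low (j ∷ e) e< = trans
    (⟨⊗⟩ (W zero) (⨂ (W ∘ suc)) (_^ j) (monomial e) (λ _ _ → refl))
    (vanish (ℕₚ.<-≤-connex j (d zero)))
    where
    vanish : j < d zero ⊎ d zero ≤ j →
             ⟨ W zero , _^ j ⟩ * ⟨ ⨂ (W ∘ suc) , monomial e ⟩ ≈ 0#
    vanish (inj₁ j<) = trans (*-congʳ (low zero j j<)) (zeroˡ _)
    vanish (inj₂ ≤j) = trans
      (*-congˡ (⨂-monomial (W ∘ suc) (d ∘ suc) (low ∘ suc) e
        (ℕₚ.≰⇒> λ ≤e → ℕₚ.<⇒≱ e< (ℕₚ.+-mono-≤ ≤j ≤e))))
      (zeroʳ _)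

  ⨂-degree : ∀ {n} (W : Vector (WeightedPoints Carrier) n) (d : Vector ℕ n) →
    (∀ i j → j < d i → ⟨ W i , _^ j ⟩ ≈ 0#) →
    ∀ {h} → DegreeBelow (sumℕ d) h → ⟨ ⨂ W , h ⟩ ≈ 0#
  ⨂-degree W d low = go
    where
    go : ∀ {h} → DegreeBelow (sumℕ d) h → ⟨ ⨂ W , h ⟩ ≈ 0#
    go (mono e e<)        = ⨂-monomial W d low e e<
    go null               = ⟨⟩-0 (⨂ W)
    go (plus {h} {h′} p q) = trans (⟨⟩-+ (⨂ W) h h′) (trans (+-cong (go p) (go q)) (+-identityʳ 0#))
    go (scale b {h} p)    = trans (⟨⟩-* (⨂ W) b h) (trans (*-congˡ (go p)) (zeroʳ b))
    go (resp h≈h′ p)      = trans (⟨⟩-cong (⨂ W) (λ x → sym (h≈h′ x))) (go p)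

  -- By induction the value is the multinomial coefficient
  -- (Σ mᵢ)! / ∏ mᵢ! times ∏ aᵢ^mᵢ: splitting off the first variable with
  -- the binomial theorem, only one term of the expansion survives.
  ⨂-powerSum : ∀ {n k} .{{_ : NonZero k}} (a : Vector Carrier n) → (∀ i → Nonzero (a i)) →
    (W : Vector (WeightedPoints Carrier) n) (m : Vector ℕ n) →
    (∀ i j → j < m i ℕ.* k → ⟨ W i , _^ j ⟩ ≈ 0#) →
    (∀ i → ⟨ W i , _^ (m i ℕ.* k) ⟩ ≈ 1#) →
    CharacteristicExceeds (sumℕ m) →
    Nonzero ⟨ ⨂ W , (λ x → powerSum a k x ^ sumℕ m) ⟩
  ⨂-powerSum {zero}  a a≉0 W m low top char ≈0 =
    1≉0 (trans (sym (trans (+-identityʳ _) (*-identityʳ 1#))) ≈0)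
  ⨂-powerSum {suc n} {k} a a≉0 W m low top char ≈0 =
    *-nonzero first≉0 rest≉0 (trans (sym expansion) ≈0)
    where
    N m₀ N′ : ℕ
    N  = sumℕ m
    m₀ = m zero
    N′ = sumℕ (m ∘ suc)

    W₀ = W zero
    W′ = ⨂ (W ∘ suc)

    head-part : ℕ → Carrier → Carrier
    head-part j b = (N C j) · ((a zero * b ^ k) ^ j)

    tail-part : ℕ → Vector Carrier n → Carrier
    tail-part j x = powerSum (a ∘ suc) k x ^ j

    term : ℕ → Carrier
    term j = ⟨ W₀ , head-part j ⟩ * ⟨ W′ , tail-part (N ∸ j) ⟩

    ⟨head-part⟩ : ∀ j → ⟨ W₀ , head-part j ⟩ ≈
                  ((N C j) · 1# * a zero ^ j) * ⟨ W₀ , _^ (j ℕ.* k) ⟩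
    ⟨head-part⟩ j = trans (⟨⟩-cong W₀ λ b → begin
      (N C j) · ((a zero * b ^ k) ^ j)
        ≈⟨ ×-congʳ (N C j) (trans (^-distrib-* (a zero) (b ^ k) j)
             (*-congˡ (trans (^-assocʳ b k j) (^-congʳ b (ℕₚ.*-comm k j))))) ⟩
      (N C j) · (a zero ^ j * b ^ (j ℕ.* k))
        ≈⟨ ×-congʳ (N C j) (*-identityˡ _) ⟨
      (N C j) · (1# * (a zero ^ j * b ^ (j ℕ.* k)))
        ≈⟨ ×-assoc-* (N C j) 1# _ ⟨
      (N C j) · 1# * (a zero ^ j * b ^ (j ℕ.* k))
        ≈⟨ *-assoc _ _ _ ⟨
      ((N C j) · 1# * a zero ^ j) * b ^ (j ℕ.* k) ∎)
      (⟨⟩-* W₀ _ _)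

    -- The `M`-th power has degree at most `M * k`, while `W′` kills all degrees below `N′ * k`.
    tail-vanishes : ∀ {M} → M < N′ → ⟨ W′ , tail-part M ⟩ ≈ 0#
    tail-vanishes {M} M<N′ = ⨂-degree (W ∘ suc) (λ i → m (suc i) ℕ.* k) (low ∘ suc)
      (weaken (≡.subst (M ℕ.* k <_) (≡.sym (sumℕ-* (m ∘ suc) k)) (ℕₚ.*-monoˡ-< k M<N′))
        (degree-^ (degree-powerSum (a ∘ suc) k) M))

    N∸m₀≡N′ : N ∸ m₀ ≡ N′
    N∸m₀≡N′ = ℕₚ.m+n∸m≡n m₀ N′

    -- For j < m₀ the first variable has exponent `j * k`, too small for `W₀`; for j > m₀ only
    -- `N ∸ j` < `N′` powers remain for the other variables.
    term≈0 : ∀ j → j ≤ N → j ≢ m₀ → term j ≈ 0#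
    term≈0 j j≤N j≢m₀ with ℕₚ.<-cmp j m₀
    ... | tri< j<m₀ _ _ = trans
      (*-congʳ (trans (⟨head-part⟩ j)
        (trans (*-congˡ (low zero _ (ℕₚ.*-monoˡ-< k j<m₀))) (zeroʳ _))))
      (zeroˡ _)
    ... | tri≈ _ j≡m₀ _ = contradiction j≡m₀ j≢m₀
    ... | tri> _ _ m₀<j = trans
      (*-congˡ (tail-vanishes (≡.subst (N ∸ j <_) N∸m₀≡N′ (ℕₚ.∸-monoʳ-< m₀<j j≤N))))
      (zeroʳ _)

    expansion : ⟨ ⨂ W , (λ x → powerSum a k x ^ N) ⟩ ≈
                ⟨ W₀ , head-part m₀ ⟩ * ⟨ W′ , tail-part N′ ⟩
    expansion = begin
      ⟨ ⨂ W , (λ x → powerSum a k x ^ N) ⟩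
        ≈⟨ ⟨⟩-cong (⨂ W) (λ x → Binomial.theorem commutativeSemiring N
             (a zero * x zero ^ k) (powerSum (a ∘ suc) k (x ∘ suc))) ⟩
      ⟨ ⨂ W , (λ x → sum {suc N} (λ j → expanded (toℕ j) x)) ⟩
        ≈⟨ ⟨⟩-sum (⨂ W) {suc N} (λ j → expanded (toℕ j)) ⟩
      sum {suc N} (λ j → ⟨ ⨂ W , expanded (toℕ j) ⟩)
        -- The binomial coefficient is absorbed into the factor of the first variable, which gives
        -- each summand the product form required by `⟨⊗⟩`.
        ≈⟨ sum-cong-≋ {suc N} (λ j → ⟨⊗⟩ W₀ W′ {expanded (toℕ j)} (head-part (toℕ j)) (tail-part (N ∸ toℕ j))
             (λ b x → sym (×-assoc-* (N C toℕ j) _ _))) ⟩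
      sum {suc N} (term ∘ toℕ)
        ≈⟨ sum-single term (ℕₚ.m≤m+n m₀ N′) term≈0 ⟩
      term m₀
        ≡⟨ ≡.cong (λ M → ⟨ W₀ , head-part m₀ ⟩ * ⟨ W′ , tail-part M ⟩) N∸m₀≡N′ ⟩
      ⟨ W₀ , head-part m₀ ⟩ * ⟨ W′ , tail-part N′ ⟩ ∎
      where
      expanded : ℕ → Vector Carrier (suc n) → Carrier
      expanded j x = (N C j) · ((a zero * x zero ^ k) ^ j * tail-part (N ∸ j) (x ∘ suc))

    -- As `W₀` sends b^(m₀k) to 1, the value is `N C m₀` times `a zero ^ m₀`.
    first≉0 : Nonzero ⟨ W₀ , head-part m₀ ⟩
    first≉0 ≈0 = *-nonzero
      (*-nonzero (C-nonzero char (ℕₚ.m≤m+n m₀ N′)) (^-nonzero (a≉0 zero) m₀)) 1≉0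
      (trans (sym (trans (⟨head-part⟩ m₀) (*-congˡ (top zero)))) ≈0)

    rest≉0 : Nonzero ⟨ W′ , tail-part N′ ⟩
    rest≉0 = ⨂-powerSum (a ∘ suc) (a≉0 ∘ suc) (W ∘ suc) (m ∘ suc) (low ∘ suc) (top ∘ suc)
      (λ j 0<j j≤N′ → char j 0<j (ℕₚ.≤-trans j≤N′ (ℕₚ.m≤n+m N′ m₀)))

  -- The product over all values and the contradiction

  ∏[_-roots_] : Carrier → List Carrier → Carrier
  ∏[ y -roots cs ] = List.foldr (λ c z → (y - c) * z) 1# cs

  ∏-vanishes : ∀ {y cs} → y ∈ₗ cs → ∏[ y -roots cs ] ≈ 0#
  ∏-vanishes {y} {c ∷ cs} (here y≈c)   = trans (*-congʳ (trans (+-congʳ y≈c) (-‿inverseʳ c))) (zeroˡ _)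
  ∏-vanishes {y} {c ∷ cs} (there y∈cs) = trans (*-congˡ (∏-vanishes y∈cs)) (zeroʳ _)

  -- Induction on `cs`, with N its length: (p + q - c)(p^N + r) equals p^(N+1) plus the new
  -- remainder (q - c)(p^N + r) + r p.
  ∏-leading : ∀ {n k} .{{_ : NonZero k}} {f p q : Vector Carrier n → Carrier} →
    DegreeBelow (suc k) p → DegreeBelow k q → (∀ x → f x ≈ p x + q x) →
    ∀ cs → ∃ λ r → DegreeBelow (length cs ℕ.* k) r ×
      (∀ x → ∏[ f x -roots cs ] ≈ p x ^ length cs + r x)
  ∏-leading p< q< f≈ [] = const 0# , null , λ x → sym (+-identityʳ 1#)
  ∏-leading {k = k} {f} {p} {q} p< q< f≈ (c ∷ cs) with ∏-leading p< q< f≈ cs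
  ... | r , r< , ∏≈ =
    (λ x → (q x - c) * (p x ^ N + r x) + r x * p x)
    -- In the first product q - c has degree below `k`, where `k` > 0 admits the constant, and p^N +
    -- r has degree at most `N * k`. In the second, r is below `N * k` and p is at most `k`.
    , plus (degree-* (plus q< (degree-constant (ℕ.>-nonZero⁻¹ k) (- c)))
                     (plus (degree-^ p< N) (weaken (ℕₚ.n≤1+n _) r<)))
           (≡.subst (λ D → DegreeBelow D (λ x → r x * p x)) (ℕₚ.+-comm (N ℕ.* k) k) (degree-* r< p<))
    , λ x → trans (*-cong (+-congʳ (f≈ x)) (∏≈ x))
        (solve 5 (λ p q c′ s r →
          ((p :+ q) :+ c′) :* (s :+ r) := p :* s :+ ((q :+ c′) :* (s :+ r) :+ r :* p))
          refl (p x) (q x) (- c) (p x ^ N) (r x))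
    where N = length cs

  -- The functional `⨂ W` is applied to the product of f - c over `cs` in two ways. Evaluated at its
  -- points, all in the product of the `A i`, the result is zero; expanded by degree, it is the
  -- nonzero contribution of the leading power.
  values-not-covered : ∀ {n k s} .{{_ : NonZero k}} (a : Vector Carrier n) → (∀ i → Nonzero (a i)) →
    (g : Polynomial n) → DegreeLessThan g k →
    (A : Fin n → Pred Carrier s) (m : Vector ℕ n) →
    (∀ i → ∃ λ xs → Unique xs × All (A i) xs × m i ℕ.* k < length xs) →
    CharacteristicExceeds (sumℕ m) →
    ∀ cs → length cs ≡ sumℕ m →
    ¬ (∀ x → (∀ i → x i ∈ A i) → eval (diagonal a k +ₚ g) x ∈ₗ cs)
  values-not-covered {n} {k} a a≉0 g g<k A m points char cs length≡ covered =
    ⨂-powerSum a a≉0 W m (λ i → proj₁ (proj₂ (proj₂ (W-exists i))))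
      (λ i → proj₂ (proj₂ (proj₂ (W-exists i)))) char leading≈0
    where
    f : Vector Carrier n → Carrier
    f = eval (diagonal a k +ₚ g)

    W-exists : ∀ i → ∃ (DividedDifference (A i) (m i ℕ.* k))
    W-exists i with points i
    ... | xs , uniq , Axs , m<  = divided-difference (A i) _ xs uniq Axs m<

    W : Vector (WeightedPoints Carrier) n
    W = proj₁ ∘ W-exists

    expansion = ∏-leading (degree-powerSum a k) (degree-eval g g<k)
      (λ x → trans (eval-++ (diagonal a k) g x) (+-congʳ (eval-diagonal a k x))) cs
    r = proj₁ expansion

    lower≈0 : ⟨ ⨂ W , r ⟩ ≈ 0#
    lower≈0 = ⨂-degree W (λ i → m i ℕ.* k) (λ i → proj₁ (proj₂ (proj₂ (W-exists i))))
      (≡.subst (λ D → DegreeBelow D r)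
        (≡.trans (≡.cong (ℕ._* k) length≡) (≡.sym (sumℕ-* m k)))
        (proj₁ (proj₂ expansion)))

    leading≈0 : ⟨ ⨂ W , (λ x → powerSum a k x ^ sumℕ m) ⟩ ≈ 0#
    leading≈0 = begin
      ⟨ ⨂ W , (λ x → powerSum a k x ^ sumℕ m) ⟩
        ≡⟨ ≡.cong (λ N → ⟨ ⨂ W , (λ x → powerSum a k x ^ N) ⟩) length≡ ⟨
      ⟨ ⨂ W , (λ x → powerSum a k x ^ length cs) ⟩
        ≈⟨ +-identityʳ _ ⟨
      ⟨ ⨂ W , (λ x → powerSum a k x ^ length cs) ⟩ + 0#
        ≈⟨ +-congˡ lower≈0 ⟨
      ⟨ ⨂ W , (λ x → powerSum a k x ^ length cs) ⟩ + ⟨ ⨂ W , r ⟩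
        ≈⟨ ⟨⟩-+ (⨂ W) _ _ ⟨
      ⟨ ⨂ W , (λ x → powerSum a k x ^ length cs + r x) ⟩
        ≈⟨ ⟨⟩-cong (⨂ W) (proj₂ (proj₂ expansion)) ⟨
      ⟨ ⨂ W , (λ x → ∏[ f x -roots cs ]) ⟩
        ≈⟨ ⟨⟩-congᵃ (All.map (λ x∈A → ∏-vanishes (covered _ x∈A))
             (All-⨂ W (λ i → proj₁ (proj₂ (W-exists i))))) ⟩
      ⟨ ⨂ W , const 0# ⟩
        ≈⟨ ⟨⟩-0 (⨂ W) ⟩
      0# ∎

  -- Bounds from the additive order and from cardinalities

  characteristic-exceeds : ∀ p → IsAdditiveOrderOf1 p → ∀ {M N} → N < p ⊓⁺ M →
                           CharacteristicExceeds N
  characteristic-exceeds [ p ] (_ , _ , nz) {M} N< j 0<j j≤N =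
    nz j 0<j (ℕₚ.≤-<-trans j≤N (ℕₚ.m<n⊓o⇒m<n p M N<))
  characteristic-exceeds ⊤⁺    nz              N< j 0<j j≤N = nz j 0<j

  HasCardinality⇒nonempty : ∀ {s} {S : Pred Carrier s} {N} →
    Satisfiable S → HasCardinality S N → 0 < N
  HasCardinality⇒nonempty (x , x∈S) ([] , _ , _ , S⊆ , _) with S⊆ x∈S
  ... | ()
  HasCardinality⇒nonempty _ (_ ∷ _ , _ , ≡.refl , _) = ℕ.z<s

⊓⁺-≤ʳ : ∀ p m → p ⊓⁺ m ≤ m
⊓⁺-≤ʳ [ p ] m = ℕₚ.m⊓n≤n p m
⊓⁺-≤ʳ ⊤⁺    m = ℕₚ.≤-refl

-- Counting the values

open import Data.Nat.Base using (_+_)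

theorem1p1 : ∀ {c ℓ s} (F : Field c ℓ) →
    let open FieldDefs F in
    (p : ℕ ⁺) → IsAdditiveOrderOf1 p →
    (n k : ℕ) .{{_ : NonZero n}} .{{_ : NonZero k}}
    (a : Vector Carrier n) → (∀ i → Nonzero (a i)) →
    (g : Polynomial n) → DegreeLessThan g k →
    (A : Fin n → Pred Carrier s) → (∀ i → Satisfiable (A i)) →
    (∣A∣ : Fin n → ℕ) → (∀ i → HasCardinality (A i) (∣A∣ i)) →
    (N : ℕ) → HasCardinality (values (diagonal a k +ₚ g) A) N →
    p ⊓⁺ (sumℕ (λ i → (∣A∣ i ∸ 1) / k) + 1) ≤ N
theorem1p1 F p p-order n k a a≉0 g g<k A A≢∅ ∣A∣ A-card N (cs , _ , ∣cs∣≡N , values⊆cs , _) =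
  ℕₚ.≮⇒≥ impossible
  where
  open Field F using (refl; setoid)
  open FieldDefs F
  open Functionals F

  M : Vector ℕ n
  M i = (∣A∣ i ∸ 1) / k

  impossible : ¬ (N < p ⊓⁺ (sumℕ M + 1))
  -- The assumed inequality is used twice: N ≤ `sumℕ M` allows a choice of `m` with sum exactly `N`,
  -- and N < p(F) keeps the multinomial coefficient nonzero.
  impossible N< with choose-below M N
    (ℕₚ.≤-pred (≡.subst (N <_) (ℕₚ.+-comm (sumℕ M) 1) (ℕₚ.<-≤-trans N< (⊓⁺-≤ʳ p _))))
  ... | m , m≤M , Σm≡N = values-not-covered a a≉0 g g<k A m points
    (≡.subst CharacteristicExceeds (≡.sym Σm≡N) (characteristic-exceeds p p-order N<))
    cs (≡.trans ∣cs∣≡N (≡.sym Σm≡N)) (λ x x∈A → values⊆cs (x , x∈A , refl))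
    where
    m*k<∣A∣ : ∀ i → m i ℕ.* k < ∣A∣ i
    m*k<∣A∣ i = ℕₚ.≤-<-trans
      (ℕₚ.≤-trans (ℕₚ.*-monoˡ-≤ k (m≤M i)) (m/n*n≤m (∣A∣ i ∸ 1) k))
      -- Truncated subtraction makes `∣A∣ i ∸ 1` smaller than `∣A∣ i` only when `A i` is nonempty.
      (ℕₚ.∸-monoʳ-< ℕ.z<s (HasCardinality⇒nonempty (A≢∅ i) (A-card i)))

    points : ∀ i → ∃ λ xs → UniqueSetoid.Unique setoid xs × All (A i) xs × m i ℕ.* k < length xs
    points i with A-card i
    ... | xs , uniq , ∣xs∣≡ , _ , xs⊆A =
      xs , uniq , tabulateₛ setoid xs⊆A , ≡.subst (m i ℕ.* k <_) (≡.sym ∣xs∣≡) (m*k<∣A∣ i)
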